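{- Let $\mathsf{C}$ be a category in which idempotents split, let $\mathbf{T}=(T,\eta^{T},\mu^{T})$ and $\mathbf{S}=(S,\eta^{S},\mu^{S})$ be monads on $\mathsf{C}$, and let $G:\mathsf{C}\to\mathsf{C}$ be an endofunctor. Let $\delta:TS\Rightarrow ST$ be a weak distributive law of monads and $\sigma:TG\Rightarrow GT$ a weak distributive law of the monad $\mathbf{T}$ over the functor $G$, and let $\widehat S,\widehat G:\mathsf{EM}(\mathbf{T})\to\mathsf{EM}(\mathbf{T})$ be the (underlying functors of the) corresponding weak liftings of $\mathbf S$ and $G$ on $\mathbf T$. Then there are functors $$\widehat{F^{T}}:\mathsf{Coalg}(GST)\to\mathsf{Coalg}(\widehat G\widehat S),\qquad \widehat{U^{T}}:\mathsf{Coalg}(\widehat G\widehat S)\to\mathsf{Coalg}(GS)$$ lifting $F^{T}:\mathsf{C}\to\mathsf{EM}(\mathbf{T})$ and $U^{T}:\mathsf{EM}(\mathbf{T})\to\mathsf{C}$ respectively, i.e. such that, denoting by $V$ the functors sending a coalgebra to its carrier, $V\circ\widehat{F^{T}}=F^{T}\circ V$ and $V\circ\widehat{U^{T}}=U^{T}\circ V$.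
   Context: $\mathsf{EM}(\mathbf{T})$ is the Eilenberg–Moore category of $\mathbf{T}$, with free functor $F^{T}$ left adjoint to the forgetful functor $U^{T}$ and counit $\varepsilon^{T}$. For an endofunctor $H$ of a category $\mathsf{D}$, $\mathsf{Coalg}(H)$ is the category of $H$-coalgebras $(X,c:X\to HX)$ and coalgebra morphisms; here $\mathsf{Coalg}(GST)$ and $\mathsf{Coalg}(GS)$ are over $\mathsf{C}$ and $\mathsf{Coalg}(\widehat G\widehat S)$ is over $\mathsf{EM}(\mathbf{T})$. A weak distributive law of monads is a natural transformation $\delta:TS\Rightarrow ST$ with $\delta\circ\mu^{T}S = S\mu^{T}\circ\delta T\circ T\delta$, $\;\delta\circ T\mu^{S}=\mu^{S}T\circ S\delta\circ\delta S$, $\;\delta\circ T\eta^{S}=\eta^{S}T$ (compatibility with $\eta^{T}$ is not required). A weak distributive law of $\mathbf{T}$ over an endofunctor $G$ is a natural transformation $\sigma:TG\Rightarrow GT$ with $\sigma\circ\mu^{T}G=G\mu^{T}\circ\sigma T\circ T\sigma$. A weak lifting of an endofunctor $H$ on $\mathbf{T}$ is a functor $\widehat H:\mathsf{EM}(\mathbf{T})\to\mathsf{EM}(\mathbf{T})$ together with natural transformations $\pi:HU^{T}\Rightarrow U^{T}\widehat H$ and $\iota:U^{T}\widehat H\Rightarrow HU^{T}$ with $\pi\circ\iota=1$. A weak lifting of the monad $\mathbf{S}$ is such data for $H=S$ with $\widehat S$ moreover a monad $(\widehat S,\eta^{\widehat S},\mu^{\widehat S})$ satisfying $\iota\circ U^{T}\mu^{\widehat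 S}=\mu^{S}U^{T}\circ S\iota\circ\iota\widehat S$, $U^{T}\mu^{\widehat S}\circ\pi\widehat S\circ S\pi=\pi\circ\mu^{S}U^{T}$, $\iota\circ U^{T}\eta^{\widehat S}=\eta^{S}U^{T}$, $\pi\circ\eta^{S}U^{T}=U^{T}\eta^{\widehat S}$. When idempotents split in $\mathsf{C}$, weak liftings correspond bijectively (up to the choice of splittings) to weak distributive laws, the law corresponding to $(\widehat H,\pi,\iota)$ being $\rho=\iota F^{T}\circ U^{T}\varepsilon^{T}\widehat HF^{T}\circ T\pi F^{T}\circ TH\eta^{T}:TH\Rightarrow HT$. (Concretely, for a $\mathbf T$-algebra $(X,x)$, the maps $\pi_{(X,x)},\iota_{(X,x)}$ split the idempotent $Hx\circ\rho_X\circ\eta^T_{HX}$ on $HX$, and the structure map of $\widehat H(X,x)$ is $\pi_{(X,x)}\circ Hx\circ\rho_X\circ T\iota_{(X,x)}$.) -}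

module Defs where

open import Level using (Level; _⊔_; suc)
open import Relation.Binary.Bundles using (Setoid)
open import Relation.Binary.Structures using (IsEquivalence)
open import Relation.Binary.PropositionalEquality using (_≡_; subst₂)
import Relation.Binary.Reasoning.Setoid as SetoidReasoning

record Category (o ℓ e : Level) : Set (suc (o ⊔ ℓ ⊔ e)) where
  infix  4 _≈_ _⇒_
  infixr 9 _∘_
  field
    Obj : Set o
    _⇒_ : Obj → Obj → Set ℓ
    _≈_ : {A B : Obj} → A ⇒ B → A ⇒ B → Set e
    id  : {A : Obj} → A ⇒ A
    _∘_ : {A B C : Obj} → B ⇒ C → A ⇒ B → A ⇒ C

    assoc     : {A B C D : Obj} {f : A ⇒ B} {g : B ⇒ C} {h : C ⇒ D} →
                (h ∘ g) ∘ f ≈ h ∘ (g ∘ f)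
    identityˡ : {A B : Obj} {f : A ⇒ B} → id ∘ f ≈ f
    identityʳ : {A B : Obj} {f : A ⇒ B} → f ∘ id ≈ f
    equiv     : {A B : Obj} → IsEquivalence (_≈_ {A} {B})
    ∘-resp-≈  : {A B C : Obj} {f h : B ⇒ C} {g i : A ⇒ B} →
                f ≈ h → g ≈ i → f ∘ g ≈ h ∘ i

  hom-setoid : (A B : Obj) → Setoid ℓ e
  hom-setoid A B = record { Carrier = A ⇒ B ; _≈_ = _≈_ ; isEquivalence = equiv }

  module Equiv {A B : Obj} = IsEquivalence (equiv {A} {B})
  module HomReasoning {A B : Obj} = SetoidReasoning (hom-setoid A B)

record Functor {o ℓ e o′ ℓ′ e′ : Level}
               (C : Category o ℓ e) (D : Category o′ ℓ′ e′)
               : Set (o ⊔ ℓ ⊔ e ⊔ o′ ⊔ ℓ′ ⊔ e′) where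
  private
    module C = Category C
    module D = Category D
  field
    F₀ : C.Obj → D.Obj
    F₁ : {A B : C.Obj} → A C.⇒ B → F₀ A D.⇒ F₀ B

    identity     : {A : C.Obj} → F₁ (C.id {A}) D.≈ D.id
    homomorphism : {X Y Z : C.Obj} {f : X C.⇒ Y} {g : Y C.⇒ Z} →
                   F₁ (g C.∘ f) D.≈ F₁ g D.∘ F₁ f
    F-resp-≈     : {A B : C.Obj} {f g : A C.⇒ B} → f C.≈ g → F₁ f D.≈ F₁ g

idF : {o ℓ e : Level} {C : Category o ℓ e} → Functor C C
idF {C = C} = record
  { F₀ = λ X → X
  ; F₁ = λ f → f
  ; identity = C.Equiv.refl
  ; homomorphism = C.Equiv.refl
  ; F-resp-≈ = λ p → p
  }
  where module C = Category C

infixr 9 _∘F_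

_∘F_ : {o ℓ e o′ ℓ′ e′ o″ ℓ″ e″ : Level}
       {C : Category o ℓ e} {D : Category o′ ℓ′ e′} {E : Category o″ ℓ″ e″} →
       Functor D E → Functor C D → Functor C E
_∘F_ {E = E} G F = record
  { F₀ = λ X → G.F₀ (F.F₀ X)
  ; F₁ = λ f → G.F₁ (F.F₁ f)
  ; identity = E.Equiv.trans (G.F-resp-≈ F.identity) G.identity
  ; homomorphism = E.Equiv.trans (G.F-resp-≈ F.homomorphism) G.homomorphism
  ; F-resp-≈ = λ p → G.F-resp-≈ (F.F-resp-≈ p)
  }
  where
    module E = Category E
    module F = Functor F
    module G = Functor G

infix 4 _≡F_

-- Strict equality of functors, not natural isomorphism: objects are compared
-- by _≡_, and morphisms by _≈_ after transport along the object equalities.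
record _≡F_ {o ℓ e o′ ℓ′ e′ : Level}
            {C : Category o ℓ e} {D : Category o′ ℓ′ e′}
            (F G : Functor C D) : Set (o ⊔ ℓ ⊔ o′ ⊔ e′) where
  private
    module C = Category C
    module D = Category D
    module F = Functor F
    module G = Functor G
  field
    eq₀ : (X : C.Obj) → F.F₀ X ≡ G.F₀ X
    eq₁ : {A B : C.Obj} (f : A C.⇒ B) →
          subst₂ D._⇒_ (eq₀ A) (eq₀ B) (F.F₁ f) D.≈ G.F₁ f

record NaturalTransformation {o ℓ e o′ ℓ′ e′ : Level}
                             {C : Category o ℓ e} {D : Category o′ ℓ′ e′}
                             (F G : Functor C D)
                             : Set (o ⊔ ℓ ⊔ ℓ′ ⊔ e′) where
  private
    module C = Category C
    module D = Category D
    module F = Functor F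
    module G = Functor G
  field
    η       : (X : C.Obj) → F.F₀ X D.⇒ G.F₀ X
    commute : {X Y : C.Obj} (f : X C.⇒ Y) →
              η Y D.∘ F.F₁ f D.≈ G.F₁ f D.∘ η X

record Splitting {o ℓ e : Level} (C : Category o ℓ e)
                 {X : Category.Obj C} (i : Category._⇒_ C X X)
                 : Set (o ⊔ ℓ ⊔ e) where
  open Category C
  field
    Y          : Obj
    retraction : X ⇒ Y
    section    : Y ⇒ X
    splits     : section ∘ retraction ≈ i
    retract    : retraction ∘ section ≈ id

IdempotentsSplit : {o ℓ e : Level} → Category o ℓ e → Set (o ⊔ ℓ ⊔ e)
IdempotentsSplit C = {X : Obj} (i : X ⇒ X) → i ∘ i ≈ i → Splitting C i
  where open Category C

record Monad {o ℓ e : Level} (C : Category o ℓ e) : Set (o ⊔ ℓ ⊔ e) where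
  open Category C
  field
    F : Functor C C
    unit : NaturalTransformation idF F
    mult : NaturalTransformation (F ∘F F) F

  open Functor F public
  module η = NaturalTransformation unit
  module μ = NaturalTransformation mult

  field
    μ-assoc     : {X : Obj} → μ.η X ∘ F₁ (μ.η X) ≈ μ.η X ∘ μ.η (F₀ X)
    μ-identityˡ : {X : Obj} → μ.η X ∘ F₁ (η.η X) ≈ id
    μ-identityʳ : {X : Obj} → μ.η X ∘ η.η (F₀ X) ≈ id

module _ {o ℓ e : Level} {C : Category o ℓ e} (T : Monad C) where
  private
    module T = Monad T
  open Category C

  record Algebra : Set (o ⊔ ℓ ⊔ e) where
    field
      carrier : Obj
      act     : T.F₀ carrier ⇒ carrier
      act-η   : act ∘ T.η.η carrier ≈ id
      act-μ   : act ∘ T.μ.η carrier ≈ act ∘ T.F₁ act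

  record AlgebraMorphism (A B : Algebra) : Set (ℓ ⊔ e) where
    private
      module A = Algebra A
      module B = Algebra B
    field
      arr      : A.carrier ⇒ B.carrier
      commutes : arr ∘ A.act ≈ B.act ∘ T.F₁ arr

  EM : Category (o ⊔ ℓ ⊔ e) (ℓ ⊔ e) e
  EM = record
    { Obj = Algebra
    ; _⇒_ = AlgebraMorphism
    ; _≈_ = λ f g → arr f ≈ arr g
    ; id = record
        { arr = id
        ; commutes = Equiv.trans identityˡ
            (Equiv.sym (Equiv.trans (∘-resp-≈ Equiv.refl T.identity) identityʳ))
        }
    ; _∘_ = comp
    ; assoc = assoc
    ; identityˡ = identityˡ
    ; identityʳ = identityʳ
    ; equiv = record { refl = Equiv.refl ; sym = Equiv.sym ; trans = Equiv.trans }
    ; ∘-resp-≈ = ∘-resp-≈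
    }
    where
      open AlgebraMorphism
      comp : {A B D : Algebra} →
             AlgebraMorphism B D → AlgebraMorphism A B → AlgebraMorphism A D
      comp {A} {B} {D} g f = record { arr = arr g ∘ arr f ; commutes = proof }
        where
          open HomReasoning
          module A = Algebra A
          module B = Algebra B
          module D = Algebra D
          proof : (arr g ∘ arr f) ∘ A.act ≈ D.act ∘ T.F₁ (arr g ∘ arr f)
          proof = begin
            (arr g ∘ arr f) ∘ A.act               ≈⟨ assoc ⟩
            arr g ∘ (arr f ∘ A.act)               ≈⟨ ∘-resp-≈ Equiv.refl (commutes f) ⟩
            arr g ∘ (B.act ∘ T.F₁ (arr f))        ≈⟨ assoc ⟨
            (arr g ∘ B.act) ∘ T.F₁ (arr f)        ≈⟨ ∘-resp-≈ (commutes g) Equiv.refl ⟩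
            (D.act ∘ T.F₁ (arr g)) ∘ T.F₁ (arr f) ≈⟨ assoc ⟩
            D.act ∘ (T.F₁ (arr g) ∘ T.F₁ (arr f)) ≈⟨ ∘-resp-≈ Equiv.refl T.homomorphism ⟨
            D.act ∘ T.F₁ (arr g ∘ arr f)          ∎

  Free : Functor C EM
  Free = record
    { F₀ = λ X → record
        { carrier = T.F₀ X
        ; act = T.μ.η X
        ; act-η = T.μ-identityʳ
        ; act-μ = Equiv.sym T.μ-assoc
        }
    ; F₁ = λ f → record { arr = T.F₁ f ; commutes = Equiv.sym (T.μ.commute f) }
    ; identity = T.identity
    ; homomorphism = T.homomorphism
    ; F-resp-≈ = T.F-resp-≈
    }

  Forgetful : Functor EM C
  Forgetful = record
    { F₀ = Algebra.carrier
    ; F₁ = AlgebraMorphism.arr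
    ; identity = Equiv.refl
    ; homomorphism = Equiv.refl
    ; F-resp-≈ = λ p → p
    }

  counit : NaturalTransformation (Free ∘F Forgetful) idF
  counit = record
    { η = λ A → record { arr = Algebra.act A ; commutes = Algebra.act-μ A }
    ; commute = λ f → Equiv.sym (AlgebraMorphism.commutes f)
    }

module _ {o ℓ e : Level} {D : Category o ℓ e} (H : Functor D D) where
  private
    module H = Functor H
  open Category D

  record Coalgebra : Set (o ⊔ ℓ) where
    field
      carrier : Obj
      str     : carrier ⇒ H.F₀ carrier

  record CoalgebraMorphism (A B : Coalgebra) : Set (ℓ ⊔ e) where
    private
      module A = Coalgebra A
      module B = Coalgebra B
    field
      arr      : A.carrier ⇒ B.carrier
      commutes : B.str ∘ arr ≈ H.F₁ arr ∘ A.str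

  Coalg : Category (o ⊔ ℓ) (ℓ ⊔ e) e
  Coalg = record
    { Obj = Coalgebra
    ; _⇒_ = CoalgebraMorphism
    ; _≈_ = λ f g → arr f ≈ arr g
    ; id = record
        { arr = id
        ; commutes = Equiv.trans identityʳ
            (Equiv.sym (Equiv.trans (∘-resp-≈ H.identity Equiv.refl) identityˡ))
        }
    ; _∘_ = comp
    ; assoc = assoc
    ; identityˡ = identityˡ
    ; identityʳ = identityʳ
    ; equiv = record { refl = Equiv.refl ; sym = Equiv.sym ; trans = Equiv.trans }
    ; ∘-resp-≈ = ∘-resp-≈
    }
    where
      open CoalgebraMorphism
      comp : {A B E : Coalgebra} →
             CoalgebraMorphism B E → CoalgebraMorphism A B → CoalgebraMorphism A E
      comp {A} {B} {E} g f = record { arr = arr g ∘ arr f ; commutes = proof }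
        where
          open HomReasoning
          module A = Coalgebra A
          module B = Coalgebra B
          module E = Coalgebra E
          proof : E.str ∘ (arr g ∘ arr f) ≈ H.F₁ (arr g ∘ arr f) ∘ A.str
          proof = begin
            E.str ∘ (arr g ∘ arr f)               ≈⟨ assoc ⟨
            (E.str ∘ arr g) ∘ arr f               ≈⟨ ∘-resp-≈ (commutes g) Equiv.refl ⟩
            (H.F₁ (arr g) ∘ B.str) ∘ arr f        ≈⟨ assoc ⟩
            H.F₁ (arr g) ∘ (B.str ∘ arr f)        ≈⟨ ∘-resp-≈ Equiv.refl (commutes f) ⟩
            H.F₁ (arr g) ∘ (H.F₁ (arr f) ∘ A.str) ≈⟨ assoc ⟨
            (H.F₁ (arr g) ∘ H.F₁ (arr f)) ∘ A.str ≈⟨ ∘-resp-≈ H.homomorphism Equiv.refl ⟨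
            H.F₁ (arr g ∘ arr f) ∘ A.str          ∎

  V : Functor Coalg D
  V = record
    { F₀ = Coalgebra.carrier
    ; F₁ = CoalgebraMorphism.arr
    ; identity = Equiv.refl
    ; homomorphism = Equiv.refl
    ; F-resp-≈ = λ p → p
    }

module _ {o ℓ e : Level} {C : Category o ℓ e} (T : Monad C) where
  private
    module T = Monad T
    module U = Functor (Forgetful T)
    module Fr = Functor (Free T)
    module ε = NaturalTransformation (counit T)
  open Category C

  record WeakDistributiveLaw (G : Functor C C) : Set (o ⊔ ℓ ⊔ e) where
    private
      module G = Functor G
    field
      law : NaturalTransformation (T.F ∘F G) (G ∘F T.F)
    open NaturalTransformation law public
    field
      compat-μᵀ : {X : Obj} →
                  η X ∘ T.μ.η (G.F₀ X) ≈ G.F₁ (T.μ.η X) ∘ η (T.F₀ X) ∘ T.F₁ (η X)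

  record WeakMonadDistributiveLaw (S : Monad C) : Set (o ⊔ ℓ ⊔ e) where
    private
      module S = Monad S
    field
      weakLaw : WeakDistributiveLaw S.F
    open WeakDistributiveLaw weakLaw public
    field
      compat-μˢ : {X : Obj} →
                  η X ∘ T.F₁ (S.μ.η X) ≈ S.μ.η (T.F₀ X) ∘ S.F₁ (η X) ∘ η (S.F₀ X)
      compat-ηˢ : {X : Obj} → η X ∘ T.F₁ (S.η.η X) ≈ S.η.η (T.F₀ X)

  record IsWeakLifting (H : Functor C C) (Ĥ : Functor (EM T) (EM T))
                       : Set (o ⊔ ℓ ⊔ e) where
    private
      module H = Functor H
      module Ĥ = Functor Ĥ
    field
      projection : NaturalTransformation (H ∘F Forgetful T) (Forgetful T ∘F Ĥ)
      inclusion  : NaturalTransformation (Forgetful T ∘F Ĥ) (H ∘F Forgetful T)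
    module π = NaturalTransformation projection
    module ι = NaturalTransformation inclusion
    field
      π∘ι : {A : Algebra T} → π.η A ∘ ι.η A ≈ id

    inducedLaw : (X : Obj) → T.F₀ (H.F₀ X) ⇒ H.F₀ (T.F₀ X)
    inducedLaw X =
      ι.η (Fr.F₀ X) ∘ U.F₁ (ε.η (Ĥ.F₀ (Fr.F₀ X))) ∘ T.F₁ (π.η (Fr.F₀ X)) ∘ T.F₁ (H.F₁ (T.η.η X))

  record WeakLifting (H : Functor C C) : Set (o ⊔ ℓ ⊔ e) where
    field
      Ĥ             : Functor (EM T) (EM T)
      isWeakLifting : IsWeakLifting H Ĥ
    open IsWeakLifting isWeakLifting public

  record WeakMonadLifting (S : Monad C) : Set (o ⊔ ℓ ⊔ e) where
    private
      module S = Monad S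
    field
      Ŝ : Monad (EM T)
    private
      module Ŝ = Monad Ŝ
    field
      isWeakLifting : IsWeakLifting S.F Ŝ.F
    open IsWeakLifting isWeakLifting public
    field
      ι-μ : {A : Algebra T} →
            ι.η A ∘ U.F₁ (Ŝ.μ.η A) ≈ S.μ.η (U.F₀ A) ∘ S.F₁ (ι.η A) ∘ ι.η (Ŝ.F₀ A)
      π-μ : {A : Algebra T} →
            U.F₁ (Ŝ.μ.η A) ∘ π.η (Ŝ.F₀ A) ∘ S.F₁ (π.η A) ≈ π.η A ∘ S.μ.η (U.F₀ A)
      ι-η : {A : Algebra T} → ι.η A ∘ U.F₁ (Ŝ.η.η A) ≈ S.η.η (U.F₀ A)
      π-η : {A : Algebra T} → π.η A ∘ S.η.η (U.F₀ A) ≈ U.F₁ (Ŝ.η.η A)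

  -- A law determines its weak lifting only up to the choice of splittings of
  -- idempotents, so "the" lifting corresponding to a law is any lifting that
  -- induces it.
  Corresponds : {H : Functor C C} → WeakDistributiveLaw H → WeakLifting H → Set (o ⊔ e)
  Corresponds ρ L = (X : Obj) → L.inducedLaw X ≈ ρ.η X
    where
      module L = WeakLifting L
      module ρ = WeakDistributiveLaw ρ

  MonadCorresponds : {S : Monad C} → WeakMonadDistributiveLaw S → WeakMonadLifting S → Set (o ⊔ e)
  MonadCorresponds δ L = (X : Obj) → L.inducedLaw X ≈ δ.η X
    where
      module L = WeakMonadLifting L
      module δ = WeakMonadDistributiveLaw δ

{-# OPTIONS --safe #-}
-- A natural transformation L H ⇒ K L lifts L to coalgebras.  For U^T it is
-- Gι^S ∘ ι^G Ŝ : U^T Ĝ Ŝ ⇒ G S U^T.  For F^T it is the transpose, under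
-- F^T ⊣ U^T, of π^G ŜF^T ∘ Gπ^S F^T : G S T ⇒ U^T Ĝ Ŝ F^T.
module Submission where

open import Level using (Level)
open import Data.Product using (Σ-syntax; _×_; _,_)
open import Relation.Binary.PropositionalEquality using (refl)
open import Defs

private
  variable
    o ℓ e o′ ℓ′ e′ o″ ℓ″ e″ : Level

module _ {C : Category o ℓ e} {D : Category o′ ℓ′ e′} where
  open Category D

  infixr 9 _∘ᵥ_

  _∘ᵥ_ : {F G H : Functor C D} →
         NaturalTransformation G H → NaturalTransformation F G → NaturalTransformation F H
  _∘ᵥ_ {F} {G} {H} β α = record
    { η = λ X → β.η X ∘ α.η X
    ; commute = λ {X} {Y} f → begin
        (β.η Y ∘ α.η Y) ∘ F.F₁ f ≈⟨ assoc ⟩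
        β.η Y ∘ (α.η Y ∘ F.F₁ f) ≈⟨ ∘-resp-≈ Equiv.refl (α.commute f) ⟩
        β.η Y ∘ (G.F₁ f ∘ α.η X) ≈⟨ assoc ⟨
        (β.η Y ∘ G.F₁ f) ∘ α.η X ≈⟨ ∘-resp-≈ (β.commute f) Equiv.refl ⟩
        (H.F₁ f ∘ β.η X) ∘ α.η X ≈⟨ assoc ⟩
        H.F₁ f ∘ (β.η X ∘ α.η X) ∎
    }
    where
      open HomReasoning
      module F = Functor F
      module G = Functor G
      module H = Functor H
      module α = NaturalTransformation α
      module β = NaturalTransformation β

module _ {C : Category o ℓ e} {D : Category o′ ℓ′ e′} {E : Category o″ ℓ″ e″} where

  infixl 10 _∘ʳ_
  infixr 10 _∘ˡ_

  _∘ʳ_ : {F G : Functor D E} →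
         NaturalTransformation F G → (K : Functor C D) →
         NaturalTransformation (F ∘F K) (G ∘F K)
  α ∘ʳ K = record { η = λ X → α.η (K.F₀ X) ; commute = λ f → α.commute (K.F₁ f) }
    where
      module α = NaturalTransformation α
      module K = Functor K

  _∘ˡ_ : {F G : Functor C D} (K : Functor D E) →
         NaturalTransformation F G → NaturalTransformation (K ∘F F) (K ∘F G)
  K ∘ˡ α = record
    { η = λ X → K.F₁ (α.η X)
    ; commute = λ f →
        Equiv.trans (Equiv.sym K.homomorphism)
          (Equiv.trans (K.F-resp-≈ (α.commute f)) K.homomorphism)
    }
    where
      open Category E
      module α = NaturalTransformation α
      module K = Functor K

module _ {C : Category o ℓ e} {D : Category o′ ℓ′ e′}
         (H : Functor C C) (K : Functor D D) (L : Functor C D)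
         (θ : NaturalTransformation (L ∘F H) (K ∘F L)) where
  private
    module C = Category C
    module H = Functor H
    module K = Functor K
    module L = Functor L
    module θ = NaturalTransformation θ
  open Category D

  coalgLift : Functor (Coalg H) (Coalg K)
  coalgLift = record
    { F₀ = λ A → record
        { carrier = L.F₀ (Coalgebra.carrier A)
        ; str = θ.η (Coalgebra.carrier A) ∘ L.F₁ (Coalgebra.str A)
        }
    ; F₁ = λ f → record
        { arr = L.F₁ (CoalgebraMorphism.arr f)
        ; commutes = lift-commutes f
        }
    -- Coalgebra morphisms are compared by their underlying arrows, and `coalgLift` acts on these as
    -- `L` does, so the functor laws are those of `L`.
    ; identity = L.identity
    ; homomorphism = L.homomorphism
    ; F-resp-≈ = L.F-resp-≈
    }
    where
      open HomReasoning
      -- Two squares are pasted: the image under `L` of the square making `f` a coalgebra morphism,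
      -- and the naturality square of `θ` at the arrow underlying `f`.
      lift-commutes : {A B : Coalgebra H} (f : CoalgebraMorphism H A B) →
        let module A = Coalgebra A
            module B = Coalgebra B
            f₁ = CoalgebraMorphism.arr f
        in (θ.η B.carrier ∘ L.F₁ B.str) ∘ L.F₁ f₁ ≈
           K.F₁ (L.F₁ f₁) ∘ θ.η A.carrier ∘ L.F₁ A.str
      lift-commutes {A} {B} f = begin
        (θ.η B.carrier ∘ L.F₁ B.str) ∘ L.F₁ f.arr        ≈⟨ assoc ⟩
        θ.η B.carrier ∘ L.F₁ B.str ∘ L.F₁ f.arr          ≈⟨ ∘-resp-≈ Equiv.refl L.homomorphism ⟨
        θ.η B.carrier ∘ L.F₁ (B.str C.∘ f.arr)           ≈⟨ ∘-resp-≈ Equiv.refl (L.F-resp-≈ f.commutes) ⟩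
        θ.η B.carrier ∘ L.F₁ (H.F₁ f.arr C.∘ A.str)      ≈⟨ ∘-resp-≈ Equiv.refl L.homomorphism ⟩
        θ.η B.carrier ∘ L.F₁ (H.F₁ f.arr) ∘ L.F₁ A.str   ≈⟨ assoc ⟨
        (θ.η B.carrier ∘ L.F₁ (H.F₁ f.arr)) ∘ L.F₁ A.str ≈⟨ ∘-resp-≈ (θ.commute f.arr) Equiv.refl ⟩
        (K.F₁ (L.F₁ f.arr) ∘ θ.η A.carrier) ∘ L.F₁ A.str ≈⟨ assoc ⟩
        K.F₁ (L.F₁ f.arr) ∘ θ.η A.carrier ∘ L.F₁ A.str   ∎
        where
          module A = Coalgebra A
          module B = Coalgebra B
          module f = CoalgebraMorphism f

  -- The carrier and the underlying arrow are literally those given by `L`, so every object equality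
  -- is `refl` and the transport along it computes away.
  V-coalgLift : V K ∘F coalgLift ≡F L ∘F V H
  V-coalgLift = record { eq₀ = λ _ → refl ; eq₁ = λ _ → Equiv.refl }

proposition15 :
    {o ℓ e : Level} (C : Category o ℓ e) → IdempotentsSplit C →
    (T S : Monad C) (G : Functor C C)
    (δ : WeakMonadDistributiveLaw T S) (σ : WeakDistributiveLaw T G)
    (Ŝ-lift : WeakMonadLifting T S) → MonadCorresponds T δ Ŝ-lift →
    (Ĝ-lift : WeakLifting T G) → Corresponds T σ Ĝ-lift →
    let Ŝ = Monad.F (WeakMonadLifting.Ŝ Ŝ-lift)
        Ĝ = WeakLifting.Ĥ Ĝ-lift
        GST = G ∘F Monad.F S ∘F Monad.F T
        GS = G ∘F Monad.F S
        ĜŜ = Ĝ ∘F Ŝ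
    in
    (Σ[ F̂ ∈ Functor (Coalg GST) (Coalg ĜŜ) ] V ĜŜ ∘F F̂ ≡F Free T ∘F V GST)
    × (Σ[ Û ∈ Functor (Coalg ĜŜ) (Coalg GS) ] V GS ∘F Û ≡F Forgetful T ∘F V ĜŜ)
proposition15 C _ T S G _ _ Ŝ-lift _ Ĝ-lift _ =
  (coalgLift GST ĜŜ (Free T) θᶠ , V-coalgLift GST ĜŜ (Free T) θᶠ) ,
  (coalgLift ĜŜ GS (Forgetful T) θᵘ , V-coalgLift ĜŜ GS (Forgetful T) θᵘ)
  where
    module Ŝ = WeakMonadLifting Ŝ-lift
    module Ĝ = WeakLifting Ĝ-lift

    GST GS : Functor C C
    GST = G ∘F Monad.F S ∘F Monad.F T
    GS = G ∘F Monad.F S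

    Ŝꟳ ĜŜ : Functor (EM T) (EM T)
    Ŝꟳ = Monad.F Ŝ.Ŝ
    ĜŜ = Ĝ.Ĥ ∘F Ŝꟳ

    -- F ∘F G ∘F H and (F ∘F G) ∘F H differ in their proof fields, so a
    -- transformation is repackaged field by field to change the bracketing.
    π² : NaturalTransformation (GS ∘F Forgetful T) (Forgetful T ∘F ĜŜ)
    π² = record { NaturalTransformation (Ĝ.projection ∘ʳ Ŝꟳ ∘ᵥ Gπ) }
      where
        Gπ : NaturalTransformation (GS ∘F Forgetful T) ((G ∘F Forgetful T) ∘F Ŝꟳ)
        Gπ = record { NaturalTransformation (G ∘ˡ Ŝ.projection) }

    -- Lifting `Forgetful T` calls for arrows out of the carrier of `ĜŜ`, hence inclusions where
    -- `π²` has projections. At each algebra this is a section of `π²`: `π∘ι` for `Ŝ`, under `G`,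
    -- cancels the inner pair, and `π∘ι` for `Ĝ` the outer one.
    θᵘ : NaturalTransformation (Forgetful T ∘F ĜŜ) (GS ∘F Forgetful T)
    θᵘ = record { NaturalTransformation (G ∘ˡ Ŝ.inclusion ∘ᵥ ιŜ) }
      where
        ιŜ : NaturalTransformation (Forgetful T ∘F ĜŜ) (G ∘F Forgetful T ∘F Ŝꟳ)
        ιŜ = record { NaturalTransformation (Ĝ.inclusion ∘ʳ Ŝꟳ) }

    -- The monad `T` enters `GST` because `π²` is taken at the free algebra on `X`, whose carrier is
    -- `T X`. The component at `X` is the algebra morphism out of the free algebra that extends this
    -- arrow: `T` applied to it, followed by the structure map of the target.
    θᶠ : NaturalTransformation (Free T ∘F GST) (ĜŜ ∘F Free T)
    θᶠ = record { NaturalTransformation (counit T ∘ʳ (ĜŜ ∘F Free T) ∘ᵥ Fπ²) }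
      where
        Fπ² : NaturalTransformation (Free T ∘F GST)
                ((Free T ∘F Forgetful T) ∘F ĜŜ ∘F Free T)
        -- Besides the bracketing, `Forgetful T ∘F Free T` in the source becomes `Monad.F T`; the
        -- two agree definitionally on objects and arrows.
        Fπ² = record { NaturalTransformation (Free T ∘ˡ (π² ∘ʳ Free T)) }
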